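{- There is an effective procedure which, given a $\Pi^0_1$ set $S\subseteq\omega$ (via a c.e. index for its complement), produces fully primitive recursive permutations $\beta,\sigma,\tau$ of $\omega$ such that the group $G$ generated by $\beta,\sigma,\tau$ has word problem $\{w\in F(\beta,\sigma,\tau): w=1 \text{ in } G\}$ in the same truth-table degree as $S$.
   Context: A permutation $\pi$ of $\omega$ is fully primitive recursive if both $\pi$ and $\pi^{ -1}$ are primitive recursive. $F(\beta,\sigma,\tau)$ is the free group on the symbols $\beta,\sigma,\tau$, with words coded by natural numbers; here the word problem of $G$ means the set of words evaluating to the identity permutation. Two sets have the same truth-table degree if each is truth-table reducible to the other. -}

module Defs where

open import Data.Nat using (ℕ; zero; suc)
open import Data.Fin using (Fin)
open import Data.Vec using (Vec; []; _∷_; lookup)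
open import Data.Bool using (Bool; true; false)
open import Data.List using (List; []; _∷_)
open import Data.Product using (Σ; _×_; _,_; proj₁; proj₂)
open import Relation.Binary.PropositionalEquality using (_≡_)
open import Function.Bundles using (_⇔_)

data PR : ℕ → Set where
  pzero : ∀ {n} → PR n
  psucc : PR 1
  pproj : ∀ {n} → Fin n → PR n
  pcomp : ∀ {m n} → PR m → Vec (PR n) m → PR n
  prec  : ∀ {n} → PR n → PR (suc (suc n)) → PR (suc n)

mutual
  evalPR : ∀ {n} → PR n → Vec ℕ n → ℕ
  evalPR pzero       xs       = 0
  evalPR psucc       (x ∷ []) = suc x
  evalPR (pproj i)   xs       = lookup xs i
  evalPR (pcomp f gs) xs      = evalPR f (evalPRs gs xs)
  evalPR (prec g h)  (zero ∷ xs)  = evalPR g xs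
  evalPR (prec g h)  (suc k ∷ xs) = evalPR h (evalPR (prec g h) (k ∷ xs) ∷ k ∷ xs)

  evalPRs : ∀ {m n} → Vec (PR n) m → Vec ℕ n → Vec ℕ m
  evalPRs []       xs = []
  evalPRs (g ∷ gs) xs = evalPR g xs ∷ evalPRs gs xs

⟦_⟧₁ : PR 1 → ℕ → ℕ
⟦ f ⟧₁ x = evalPR f (x ∷ [])

-- A pair of unary PR codes (f , g) presents a fully primitive recursive
-- permutation of ω: f is a bijection with inverse g (both PR).
FPRPerm : PR 1 → PR 1 → Set
FPRPerm f g = (∀ x → ⟦ f ⟧₁ (⟦ g ⟧₁ x) ≡ x) × (∀ x → ⟦ g ⟧₁ (⟦ f ⟧₁ x) ≡ x)

-- Π⁰₁ sets, presented by a PR code p of arity 2 (Kleene normal form):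
--   n ∉ S  ⇔  ∃ s. p(n,s) ≠ 0   (complement c.e., p is its index)
--   n ∈ S  ⇔  ∀ s. p(n,s) = 0

PiSet : PR 2 → ℕ → Set
PiSet p n = ∀ s → evalPR p (n ∷ s ∷ []) ≡ 0

-- Words of the free group F(β,σ,τ): lists of letters; a letter is a
-- generator (Fin 3: 0 = β, 1 = σ, 2 = τ) with an exponent flag
-- (true = the generator, false = its inverse).

Letter : Set
Letter = Fin 3 × Bool

Word : Set
Word = List Letter

-- Evaluate a word on three (permutation, inverse) pairs of functions,
-- as the composite x₁ ∘ x₂ ∘ ⋯ ∘ xₙ acting on ω.
evalWord : (Fin 3 → (ℕ → ℕ) × (ℕ → ℕ)) → Word → ℕ → ℕ
evalWord gens []                  x = x
evalWord gens ((i , true)  ∷ w)   x = proj₁ (gens i) (evalWord gens w x)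
evalWord gens ((i , false) ∷ w)   x = proj₂ (gens i) (evalWord gens w x)

gensOf : (Fin 3 → PR 1 × PR 1) → Fin 3 → (ℕ → ℕ) × (ℕ → ℕ)
gensOf c i = ⟦ proj₁ (c i) ⟧₁ , ⟦ proj₂ (c i) ⟧₁

WordProblem : (Fin 3 → PR 1 × PR 1) → Word → Set
WordProblem c w = ∀ x → evalWord (gensOf c) w x ≡ x

-- A ≤tt B: a (total, computable = Agda)
-- function assigning to each x a finite list of queries to B and a
-- Boolean truth table, such that for any correct answer vector, x ∈ A
-- iff the table evaluates to true.

TTReduction : {X Y : Set} → (X → Set) → (Y → Set) → Set
TTReduction {X} {Y} A B =
  Σ (X → Σ ℕ λ k → Vec Y k × (Vec Bool k → Bool)) λ r →
    ∀ x → (bs : Vec Bool (proj₁ (r x))) →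
      (∀ i → (lookup bs i ≡ true) ⇔ B (lookup (proj₁ (proj₂ (r x))) i)) →
      A x ⇔ (proj₂ (proj₂ (r x)) bs ≡ true)

_≤tt_ : {X Y : Set} → (X → Set) → (Y → Set) → Set
A ≤tt B = TTReduction A B

_≡tt_ : {X Y : Set} → (X → Set) → (Y → Set) → Set
A ≡tt B = (A ≤tt B) × (B ≤tt A)

-- Identify ω with ℤ × ℕ × ℕ × ℕ (Cantor pairing, zigzag coding of ℤ); a point (c, k, s, x) lies
-- in copy (k, s) of the line ℤ. σ moves c by one, τ is the identity, and β applies to the fibre
-- point x ∈ {0, 1, 2} the swap (0 1) or (1 2) labelling position c in that copy: copy (0, s)
-- carries (1 2) at 0, copy (n + 1, s) carries (0 1) at 0 and, once some stage t < s refutes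
-- n ∈ S, also (1 2) at n + 1.
--
-- Since (0 1)(1 2) has order 3, the word (β σ^(n+1) β σ^-(n+1))² is trivial iff no copy has the
-- two swaps at distance n + 1, i.e. iff n ∈ S: a one-query reduction. Conversely a word w only
-- sees labels within distance ∣w∣, so once the copies with a single swap are checked, a copy with
-- swaps at distance n + 1 > 2∣w∣ cannot break w; triviality of w is thus a Boolean combination of
-- decidable facts and the answers to "n ∈ S" for n < 2∣w∣.

module Submission where

open import Defs
open import Data.Bool as Bool using (Bool; true; false)
open import Data.Fin using (Fin; zero; suc; toℕ; fromℕ<)
open import Data.Fin.Properties using (all?; toℕ-fromℕ<)
open import Data.Integer as ℤ using (ℤ; +_; -[1+_]; 0ℤ; 1ℤ; -1ℤ; ∣_∣)
import Data.Integer.Properties as ℤₚ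
open import Data.Integer.Tactic.RingSolver using (solve-∀)
open import Data.Nat
  using (ℕ; zero; suc; _+_; _∸_; ∣_-_∣; pred; _≤_; _<_; z≤n; s≤s; s≤s⁻¹; _≟_; _≤?_; _<?_)
open import Data.Nat.Properties
open import Data.Product using (Σ; _×_; _,_; proj₁; proj₂)
open import Data.Sum as Sum using (_⊎_; inj₁; inj₂)
open import Data.List using ([]; _∷_; length)
open import Data.Vec using (Vec; []; _∷_; lookup; map; tabulate)
open import Data.Vec.Properties using (lookup∘tabulate)
open import Relation.Binary.PropositionalEquality
open import Function using (_∘_)
open import Function.Bundles using (_⇔_; mk⇔; Equivalence)
open import Function.Construct.Composition using (_⇔-∘_)
open import Function.Construct.Symmetry using (⇔-sym)
open import Relation.Binary.Definitions using (tri<; tri≈; tri>)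
open import Relation.Nullary using (¬_; Dec; yes; no; does; contradiction)
open import Relation.Nullary.Decidable using (map′; _×-dec_; _⊎-dec_; dec-no)

record PRFun (n : ℕ) : Set where
  constructor prFun
  field
    code         : PR n
    fun          : Vec ℕ n → ℕ
    code-correct : ∀ xs → evalPR code xs ≡ fun xs
open PRFun public

compose : ∀ {m n} → PRFun m → Vec (PRFun n) m → PRFun n
compose {n = n} f gs =
  prFun (pcomp (code f) (map code gs)) (λ xs → fun f (map (λ g → fun g xs) gs))
        (λ xs → trans (cong (evalPR (code f)) (args xs gs)) (code-correct f _))
  where
  args : ∀ {k} xs (hs : Vec (PRFun n) k) → evalPRs (map code hs) xs ≡ map (λ g → fun g xs) hs
  args xs []       = refl
  args xs (h ∷ hs) = cong₂ _∷_ (code-correct h xs) (args xs hs)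

_⟨_⟩₁ : ∀ {n} → PRFun 1 → PRFun n → PRFun n
f ⟨ g ⟩₁ = compose f (g ∷ [])

_⟨_,_⟩₂ : ∀ {n} → PRFun 2 → PRFun n → PRFun n → PRFun n
f ⟨ g , h ⟩₂ = compose f (g ∷ h ∷ [])

_⟨_,_,_⟩₃ : ∀ {n} → PRFun 3 → PRFun n → PRFun n → PRFun n → PRFun n
f ⟨ g , h , k ⟩₃ = compose f (g ∷ h ∷ k ∷ [])

projᴾ : ∀ {n} → Fin n → PRFun n
projᴾ i = prFun (pproj i) (λ xs → lookup xs i) (λ _ → refl)

x₀ : ∀ {n} → PRFun (suc n)
x₀ = projᴾ zero

x₁ : ∀ {n} → PRFun (suc (suc n))
x₁ = projᴾ (suc zero)

x₂ : ∀ {n} → PRFun (suc (suc (suc n)))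
x₂ = projᴾ (suc (suc zero))

x₃ : ∀ {n} → PRFun (suc (suc (suc (suc n))))
x₃ = projᴾ (suc (suc (suc zero)))

zeroᴾ : ∀ {n} → PRFun n
zeroᴾ = prFun pzero (λ _ → 0) (λ _ → refl)

sucᴾ : PRFun 1
sucᴾ = prFun psucc (λ { (x ∷ []) → suc x }) (λ { (x ∷ []) → refl })

oneᴾ twoᴾ : ∀ {n} → PRFun n
oneᴾ = sucᴾ ⟨ zeroᴾ ⟩₁
twoᴾ = sucᴾ ⟨ oneᴾ ⟩₁

-- f is given together with its recursion equations, so that fun stays the readable f
-- instead of an unfolding of prec; composite codes then compute their meaning by refl.
recursion : ∀ {n} (g : PRFun n) (h : PRFun (suc (suc n))) (f : Vec ℕ (suc n) → ℕ) →
            (∀ xs → f (zero ∷ xs) ≡ fun g xs) →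
            (∀ k xs → f (suc k ∷ xs) ≡ fun h (f (k ∷ xs) ∷ k ∷ xs)) →
            PRFun (suc n)
recursion g h f f-zero f-suc = prFun (prec (code g) (code h)) f correct
  where
  correct : ∀ xs → evalPR (prec (code g) (code h)) xs ≡ f xs
  correct (zero ∷ xs)  = trans (code-correct g xs) (sym (f-zero xs))
  correct (suc k ∷ xs) = begin
    evalPR (code h) (previous ∷ k ∷ xs) ≡⟨ code-correct h _ ⟩
    fun h (previous ∷ k ∷ xs)           ≡⟨ cong (λ v → fun h (v ∷ k ∷ xs)) (correct (k ∷ xs)) ⟩
    fun h (f (k ∷ xs) ∷ k ∷ xs)         ≡⟨ f-suc k xs ⟨
    f (suc k ∷ xs)                      ∎
    where
    open ≡-Reasoning
    previous = evalPR (prec (code g) (code h)) (k ∷ xs)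

ifz : ℕ → ℕ → ℕ → ℕ
ifz zero    a b = a
ifz (suc _) a b = b

addᴾ : PRFun 2
addᴾ = recursion x₀ (sucᴾ ⟨ x₀ ⟩₁) (λ { (x ∷ y ∷ []) → x + y })
                 (λ { (y ∷ []) → refl }) (λ { k (y ∷ []) → refl })

predᴾ : PRFun 1
predᴾ = recursion zeroᴾ x₁ (λ { (x ∷ []) → pred x }) (λ { [] → refl }) (λ { k [] → refl })

monusᴾ : PRFun 2
monusᴾ = flipped ⟨ x₁ , x₀ ⟩₂
  where
  flipped : PRFun 2
  flipped = recursion x₀ (predᴾ ⟨ x₀ ⟩₁) (λ { (y ∷ x ∷ []) → x ∸ y })
                      (λ { (x ∷ []) → refl }) (λ { k (x ∷ []) → sym (pred[m∸n]≡m∸[1+n] x k) })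

ifzᴾ : PRFun 3
ifzᴾ = recursion x₀ x₃ (λ { (c ∷ a ∷ b ∷ []) → ifz c a b })
                 (λ { (a ∷ b ∷ []) → refl }) (λ { k (a ∷ b ∷ []) → refl })

distanceᴾ : PRFun 2
distanceᴾ = prFun (code formula) (λ { (m ∷ n ∷ []) → ∣ m - n ∣ })
                  (λ { (m ∷ n ∷ []) → trans (code-correct formula (m ∷ n ∷ [])) (∸+∸≡∣-∣ m n) })
  where
  formula : PRFun 2
  formula = addᴾ ⟨ monusᴾ ⟨ x₀ , x₁ ⟩₂ , monusᴾ ⟨ x₁ , x₀ ⟩₂ ⟩₂
  ∸+∸≡∣-∣ : ∀ m n → (m ∸ n) + (n ∸ m) ≡ ∣ m - n ∣
  ∸+∸≡∣-∣ zero    zero    = refl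
  ∸+∸≡∣-∣ zero    (suc n) = refl
  ∸+∸≡∣-∣ (suc m) zero    = +-identityʳ (suc m)
  ∸+∸≡∣-∣ (suc m) (suc n) = ∸+∸≡∣-∣ m n

ifz-∣-∣ : ∀ {m n a b} → m ≢ n → ifz ∣ m - n ∣ a b ≡ b
ifz-∣-∣ {m} {n} m≢n with ∣ m - n ∣ in eq
... | zero  = contradiction (∣m-n∣≡0⇒m≡n eq) m≢n
... | suc _ = refl

triangle : ℕ → ℕ
triangle zero    = 0
triangle (suc n) = suc n + triangle n

-- diagonal z is the d with triangle d ≤ z ≤ triangle d + d; z + 1 opens a new
-- diagonal exactly when z is the last point of its own, z = triangle d + d.
diagonal : ℕ → ℕ
diagonal zero    = 0
diagonal (suc z) = ifz (diagonal z ∸ (z ∸ triangle (diagonal z))) (suc (diagonal z)) (diagonal z)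

pair : ℕ → ℕ → ℕ
pair a b = triangle (a + b) + b

unpair₂ : ℕ → ℕ
unpair₂ z = z ∸ triangle (diagonal z)

unpair₁ : ℕ → ℕ
unpair₁ z = diagonal z ∸ unpair₂ z

OnDiagonal : ℕ → ℕ → Set
OnDiagonal d z = triangle d ≤ z × z ≤ triangle d + d

triangle-suc : ∀ d → triangle (suc d) ≡ suc (triangle d + d)
triangle-suc d = cong suc (+-comm d (triangle d))

triangle-mono-≤ : ∀ {m n} → m ≤ n → triangle m ≤ triangle n
triangle-mono-≤ {zero}              _         = z≤n
triangle-mono-≤ {suc m} {suc n} (s≤s m≤n) = +-mono-≤ (s≤s m≤n) (triangle-mono-≤ m≤n)

diagonal-onDiagonal : ∀ z → OnDiagonal (diagonal z) z
diagonal-onDiagonal zero    = z≤n , z≤n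
diagonal-onDiagonal (suc z) with diagonal-onDiagonal z
... | lower , upper with diagonal z ∸ (z ∸ triangle (diagonal z)) in eq
... | zero  = ≤-reflexive (sym z+1≡) , ≤-trans (≤-reflexive z+1≡) (m≤m+n _ _)
  where
  d = diagonal z
  z≡ : z ≡ triangle d + d
  z≡ = trans (sym (m+[n∸m]≡n lower))
             (cong (λ t → triangle d + t) (≤-antisym (m≤n+o⇒m∸n≤o z (triangle d) upper) (m∸n≡0⇒m≤n eq)))
  z+1≡ : suc z ≡ triangle (suc d)
  z+1≡ = trans (cong suc z≡) (sym (triangle-suc d))
... | suc _ = m≤n⇒m≤1+n lower ,
              subst (_≤ triangle d + d) (cong suc (m+[n∸m]≡n lower)) (+-monoʳ-< (triangle d) offset<d)
  where
  d = diagonal z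
  offset<d : z ∸ triangle d < d
  offset<d = m∸n≢0⇒n<m (λ eq′ → contradiction (trans (sym eq) eq′) λ ())

triangle-+-< : ∀ {m n} → m < n → triangle m + m < triangle n
triangle-+-< {m} m<n = ≤-trans (≤-reflexive (sym (triangle-suc m))) (triangle-mono-≤ m<n)

onDiagonal-unique : ∀ {d e z} → OnDiagonal d z → OnDiagonal e z → d ≡ e
onDiagonal-unique {d} {e} (d-lower , d-upper) (e-lower , e-upper) with <-cmp d e
... | tri< d<e _ _ = contradiction (≤-<-trans d-upper (<-≤-trans (triangle-+-< d<e) e-lower)) (n≮n _)
... | tri≈ _ d≡e _ = d≡e
... | tri> _ _ e<d = contradiction (≤-<-trans e-upper (<-≤-trans (triangle-+-< e<d) d-lower)) (n≮n _)

diagonal-pair : ∀ a b → diagonal (pair a b) ≡ a + b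
diagonal-pair a b = onDiagonal-unique (diagonal-onDiagonal (pair a b))
                                      (m≤m+n _ b , +-monoʳ-≤ (triangle (a + b)) (m≤n+m b a))

unpair₂-pair : ∀ a b → unpair₂ (pair a b) ≡ b
unpair₂-pair a b rewrite diagonal-pair a b = m+n∸m≡n (triangle (a + b)) b

unpair₁-pair : ∀ a b → unpair₁ (pair a b) ≡ a
unpair₁-pair a b rewrite unpair₂-pair a b | diagonal-pair a b = m+n∸n≡m a b

pair-unpair : ∀ z → pair (unpair₁ z) (unpair₂ z) ≡ z
pair-unpair z = begin
  triangle (diagonal z ∸ b + b) + b ≡⟨ cong (λ d → triangle d + b) (m∸n+n≡m b≤diagonal) ⟩
  triangle (diagonal z) + b         ≡⟨ m+[n∸m]≡n lower ⟩
  z                                 ∎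
  where
  open ≡-Reasoning
  b = unpair₂ z
  lower : triangle (diagonal z) ≤ z
  lower = proj₁ (diagonal-onDiagonal z)
  b≤diagonal : b ≤ diagonal z
  b≤diagonal = m≤n+o⇒m∸n≤o z (triangle (diagonal z)) (proj₂ (diagonal-onDiagonal z))

triangleᴾ : PRFun 1
triangleᴾ = recursion zeroᴾ (addᴾ ⟨ sucᴾ ⟨ x₁ ⟩₁ , x₀ ⟩₂) (λ { (n ∷ []) → triangle n })
                      (λ { [] → refl }) (λ { k [] → refl })

diagonalᴾ : PRFun 1
diagonalᴾ = recursion zeroᴾ
                      (ifzᴾ ⟨ monusᴾ ⟨ x₀ , monusᴾ ⟨ x₁ , triangleᴾ ⟨ x₀ ⟩₁ ⟩₂ ⟩₂ , sucᴾ ⟨ x₀ ⟩₁ , x₀ ⟩₃)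
                      (λ { (n ∷ []) → diagonal n }) (λ { [] → refl }) (λ { k [] → refl })

unpair₂ᴾ : PRFun 1
unpair₂ᴾ = monusᴾ ⟨ x₀ , triangleᴾ ⟨ diagonalᴾ ⟩₁ ⟩₂

unpair₁ᴾ : PRFun 1
unpair₁ᴾ = monusᴾ ⟨ diagonalᴾ , unpair₂ᴾ ⟩₂

pairᴾ : PRFun 2
pairᴾ = addᴾ ⟨ triangleᴾ ⟨ addᴾ ⟨ x₀ , x₁ ⟩₂ ⟩₁ , x₁ ⟩₂

encodeℤ : ℤ → ℕ
encodeℤ (+ n)    = n + n
encodeℤ -[1+ n ] = suc (n + n)

mirror : ℤ → ℤ
mirror (+ n)    = -[1+ n ]
mirror -[1+ n ] = + suc n

decodeℤ : ℕ → ℤ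
decodeℤ zero    = 0ℤ
decodeℤ (suc m) = mirror (decodeℤ m)

encodeℤ-mirror : ∀ c → encodeℤ (mirror c) ≡ suc (encodeℤ c)
encodeℤ-mirror (+ n)    = refl
encodeℤ-mirror -[1+ n ] = cong suc (+-suc n n)

encodeℤ-decodeℤ : ∀ m → encodeℤ (decodeℤ m) ≡ m
encodeℤ-decodeℤ zero    = refl
encodeℤ-decodeℤ (suc m) = trans (encodeℤ-mirror (decodeℤ m)) (cong suc (encodeℤ-decodeℤ m))

decodeℤ-encodeℤ : ∀ c → decodeℤ (encodeℤ c) ≡ c
decodeℤ-encodeℤ (+ n)    = decodeℤ-double n
  where
  decodeℤ-double : ∀ n → decodeℤ (n + n) ≡ + n
  decodeℤ-double zero    = refl
  decodeℤ-double (suc n) rewrite +-suc n n | decodeℤ-double n = refl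
decodeℤ-encodeℤ -[1+ n ] = cong mirror (decodeℤ-encodeℤ (+ n))

encodeℤ-injective : ∀ {c d} → encodeℤ c ≡ encodeℤ d → c ≡ d
encodeℤ-injective {c} {d} eq = trans (sym (decodeℤ-encodeℤ c)) (trans (cong decodeℤ eq) (decodeℤ-encodeℤ d))

parity : ℕ → ℕ
parity zero    = 0
parity (suc n) = ifz (parity n) 1 0

parity-even : ∀ n → parity (n + n) ≡ 0
parity-odd  : ∀ n → parity (suc (n + n)) ≡ 1
parity-even zero    = refl
parity-even (suc n) rewrite +-suc n n | parity-odd n = refl
parity-odd n rewrite parity-even n = refl

parityᴾ : PRFun 1
parityᴾ = recursion zeroᴾ (ifzᴾ ⟨ x₀ , oneᴾ , zeroᴾ ⟩₃) (λ { (n ∷ []) → parity n })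
                    (λ { [] → refl }) (λ { k [] → refl })

incrementCode decrementCode : ℕ → ℕ
incrementCode m = ifz (parity m) (m + 2) (ifz (m ∸ 1) 0 (m ∸ 2))
decrementCode m = ifz m 1 (ifz (parity m) (m ∸ 2) (m + 2))

incrementCode-correct : ∀ c → incrementCode (encodeℤ c) ≡ encodeℤ (c ℤ.+ 1ℤ)
incrementCode-correct (+ n) rewrite parity-even n | +-comm n 1 =
  trans (+-comm (n + n) 2) (cong suc (sym (+-suc n n)))
incrementCode-correct -[1+ zero ]  = refl
incrementCode-correct -[1+ suc n ] rewrite +-suc n n | parity-even n = refl

decrementCode-correct : ∀ c → decrementCode (encodeℤ c) ≡ encodeℤ (c ℤ.+ -1ℤ)
decrementCode-correct (+ zero)  = refl
decrementCode-correct (+ suc n) rewrite +-suc n n | parity-odd n = refl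
decrementCode-correct -[1+ n ]  rewrite parity-odd n | +-identityʳ n =
  trans (+-comm (suc (n + n)) 2) (cong (λ m → suc (suc m)) (sym (+-suc n n)))

incrementCodeᴾ decrementCodeᴾ : PRFun 1
incrementCodeᴾ = ifzᴾ ⟨ parityᴾ ⟨ x₀ ⟩₁ , addᴾ ⟨ x₀ , twoᴾ ⟩₂ ,
                       ifzᴾ ⟨ monusᴾ ⟨ x₀ , oneᴾ ⟩₂ , zeroᴾ , monusᴾ ⟨ x₀ , twoᴾ ⟩₂ ⟩₃ ⟩₃
decrementCodeᴾ = ifzᴾ ⟨ x₀ , oneᴾ ,
                       ifzᴾ ⟨ parityᴾ ⟨ x₀ ⟩₁ , monusᴾ ⟨ x₀ , twoᴾ ⟩₂ , addᴾ ⟨ x₀ , twoᴾ ⟩₂ ⟩₃ ⟩₃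

encodePoint : ℤ → ℕ → ℕ → ℕ → ℕ
encodePoint c k s x = pair (encodeℤ c) (pair k (pair s x))

decodePoint : ℕ → ℤ × ℕ × ℕ × ℕ
decodePoint z =
  decodeℤ (unpair₁ z) , unpair₁ (unpair₂ z) , unpair₁ (unpair₂ (unpair₂ z)) , unpair₂ (unpair₂ (unpair₂ z))

decodePoint-encodePoint : ∀ c k s x → decodePoint (encodePoint c k s x) ≡ (c , k , s , x)
decodePoint-encodePoint c k s x
  rewrite unpair₁-pair (encodeℤ c) (pair k (pair s x)) | unpair₂-pair (encodeℤ c) (pair k (pair s x))
        | unpair₁-pair k (pair s x) | unpair₂-pair k (pair s x) | unpair₁-pair s x | unpair₂-pair s x
        | decodeℤ-encodeℤ c = refl

encodePoint-decodePoint : ∀ z → let (c , k , s , x) = decodePoint z in encodePoint c k s x ≡ z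
encodePoint-decodePoint z
  rewrite encodeℤ-decodeℤ (unpair₁ z) | pair-unpair (unpair₂ (unpair₂ z)) | pair-unpair (unpair₂ z) = pair-unpair z

point-induction : (P : ℕ → Set) → (∀ c k s x → P (encodePoint c k s x)) → ∀ z → P z
point-induction P h z = let (c , k , s , x) = decodePoint z in subst P (encodePoint-decodePoint z) (h c k s x)

σᴾ σ⁻ᴾ : PRFun 1
σᴾ  = pairᴾ ⟨ incrementCodeᴾ ⟨ unpair₁ᴾ ⟩₁ , unpair₂ᴾ ⟩₂
σ⁻ᴾ = pairᴾ ⟨ decrementCodeᴾ ⟨ unpair₁ᴾ ⟩₁ , unpair₂ᴾ ⟩₂

σ-encodePoint : ∀ c k s x → ⟦ code σᴾ ⟧₁ (encodePoint c k s x) ≡ encodePoint (c ℤ.+ 1ℤ) k s x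
σ-encodePoint c k s x = trans (code-correct σᴾ (encodePoint c k s x ∷ [])) unfolded
  where
  unfolded : fun σᴾ (encodePoint c k s x ∷ []) ≡ encodePoint (c ℤ.+ 1ℤ) k s x
  unfolded rewrite unpair₁-pair (encodeℤ c) (pair k (pair s x)) | unpair₂-pair (encodeℤ c) (pair k (pair s x))
                 | incrementCode-correct c = refl

σ⁻-encodePoint : ∀ c k s x → ⟦ code σ⁻ᴾ ⟧₁ (encodePoint c k s x) ≡ encodePoint (c ℤ.+ -1ℤ) k s x
σ⁻-encodePoint c k s x = trans (code-correct σ⁻ᴾ (encodePoint c k s x ∷ [])) unfolded
  where
  unfolded : fun σ⁻ᴾ (encodePoint c k s x ∷ []) ≡ encodePoint (c ℤ.+ -1ℤ) k s x
  unfolded rewrite unpair₁-pair (encodeℤ c) (pair k (pair s x)) | unpair₂-pair (encodeℤ c) (pair k (pair s x))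
                 | decrementCode-correct c = refl

data Swap : Set where
  none swap₀₁ swap₁₂ : Swap

applySwap : Swap → ℕ → ℕ
applySwap none   x                   = x
applySwap swap₀₁ 0                   = 1
applySwap swap₀₁ 1                   = 0
applySwap swap₀₁ x@(suc (suc _))     = x
applySwap swap₁₂ 0                   = 0
applySwap swap₁₂ 1                   = 2
applySwap swap₁₂ 2                   = 1
applySwap swap₁₂ x@(suc (suc (suc _))) = x

applySwap-involutive : ∀ π x → applySwap π (applySwap π x) ≡ x
applySwap-involutive none   x                     = refl
applySwap-involutive swap₀₁ 0                     = refl
applySwap-involutive swap₀₁ 1                     = refl
applySwap-involutive swap₀₁ (suc (suc x))         = refl
applySwap-involutive swap₁₂ 0                     = refl
applySwap-involutive swap₁₂ 1                     = refl
applySwap-involutive swap₁₂ 2                     = refl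
applySwap-involutive swap₁₂ (suc (suc (suc x)))   = refl

applySwap-≥3 : ∀ π x → applySwap π (3 + x) ≡ 3 + x
applySwap-≥3 none   x = refl
applySwap-≥3 swap₀₁ x = refl
applySwap-≥3 swap₁₂ x = refl

swapᴾ : Swap → PRFun 1
swapᴾ π = prFun (code (formula π)) (λ { (x ∷ []) → applySwap π x })
                 (λ { (x ∷ []) → trans (code-correct (formula π) (x ∷ [])) (correct π x) })
  where
  formula : Swap → PRFun 1
  formula none   = x₀
  formula swap₀₁ = ifzᴾ ⟨ x₀ , oneᴾ , ifzᴾ ⟨ monusᴾ ⟨ x₀ , oneᴾ ⟩₂ , zeroᴾ , x₀ ⟩₃ ⟩₃
  formula swap₁₂ = ifzᴾ ⟨ x₀ , zeroᴾ ,
                         ifzᴾ ⟨ monusᴾ ⟨ x₀ , oneᴾ ⟩₂ , twoᴾ , ifzᴾ ⟨ monusᴾ ⟨ x₀ , twoᴾ ⟩₂ , oneᴾ , x₀ ⟩₃ ⟩₃ ⟩₃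
  correct : ∀ π x → fun (formula π) (x ∷ []) ≡ applySwap π x
  correct none   x                   = refl
  correct swap₀₁ 0                   = refl
  correct swap₀₁ 1                   = refl
  correct swap₀₁ (suc (suc x))       = refl
  correct swap₁₂ 0                   = refl
  correct swap₁₂ 1                   = refl
  correct swap₁₂ 2                   = refl
  correct swap₁₂ (suc (suc (suc x))) = refl

square : Swap → Swap → ℕ → ℕ
square π ρ x = applySwap π (applySwap ρ (applySwap π (applySwap ρ x)))

Clash : Swap → Swap → Set
Clash π ρ = (π ≡ swap₀₁ × ρ ≡ swap₁₂) ⊎ (π ≡ swap₁₂ × ρ ≡ swap₀₁)

square-identity : ∀ π ρ → ¬ Clash π ρ → ∀ x → square π ρ x ≡ x
square-identity none   ρ      _ x = applySwap-involutive ρ x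
square-identity swap₀₁ none   _ x = applySwap-involutive swap₀₁ x
square-identity swap₁₂ none   _ x = applySwap-involutive swap₁₂ x
square-identity swap₀₁ swap₀₁ _ x rewrite applySwap-involutive swap₀₁ x = applySwap-involutive swap₀₁ x
square-identity swap₁₂ swap₁₂ _ x rewrite applySwap-involutive swap₁₂ x = applySwap-involutive swap₁₂ x
square-identity swap₀₁ swap₁₂ ¬clash x = contradiction (inj₁ (refl , refl)) ¬clash
square-identity swap₁₂ swap₀₁ ¬clash x = contradiction (inj₂ (refl , refl)) ¬clash

Labelling : Set
Labelling = ℤ → Swap

pattern β = zero
pattern σ = suc zero
pattern τ = suc (suc zero)

shift : Word → ℤ
shift []              = 0ℤ
shift ((β , _) ∷ w)     = shift w
shift ((σ , true) ∷ w)  = shift w ℤ.+ 1ℤ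
shift ((σ , false) ∷ w) = shift w ℤ.+ -1ℤ
shift ((τ , _) ∷ w)     = shift w

-- evalWord applies the last letter first, so a β-letter reads its label at the position
-- reached by the suffix after it.
run : Labelling → Word → ℤ → ℕ → ℕ
run L []              c x = x
run L ((β , _) ∷ w)     c x = applySwap (L (c ℤ.+ shift w)) (run L w c x)
run L ((suc _ , _) ∷ w) c x = run L w c x

Fixes : Labelling → Word → Set
Fixes L w = ∀ c x → run L w c x ≡ x

Trivial : Labelling → Word → Set
Trivial L w = shift w ≡ 0ℤ × Fixes L w

∣i+unit∣≤1+ : ∀ i u {l} → ∣ u ∣ ≡ 1 → ∣ i ∣ ≤ l → ∣ i ℤ.+ u ∣ ≤ suc l
∣i+unit∣≤1+ i u {l} ∣u∣≡1 ∣i∣≤l =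
  ≤-trans (ℤₚ.∣i+j∣≤∣i∣+∣j∣ i u)
          (≤-trans (+-monoˡ-≤ ∣ u ∣ ∣i∣≤l) (≤-reflexive (trans (cong (_+_ l) ∣u∣≡1) (+-comm l 1))))

∣shift∣≤length : ∀ w → ∣ shift w ∣ ≤ length w
∣shift∣≤length []              = z≤n
∣shift∣≤length ((β , _) ∷ w)     = m≤n⇒m≤1+n (∣shift∣≤length w)
∣shift∣≤length ((σ , true) ∷ w)  = ∣i+unit∣≤1+ (shift w) 1ℤ refl (∣shift∣≤length w)
∣shift∣≤length ((σ , false) ∷ w) = ∣i+unit∣≤1+ (shift w) -1ℤ refl (∣shift∣≤length w)
∣shift∣≤length ((τ , _) ∷ w)     = m≤n⇒m≤1+n (∣shift∣≤length w)

run-local : ∀ (L L′ : Labelling) w c c′ x →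
            (∀ δ → ∣ δ ∣ ≤ length w → L (c ℤ.+ δ) ≡ L′ (c′ ℤ.+ δ)) →
            run L w c x ≡ run L′ w c′ x
run-local L L′ []                 c c′ x agree = refl
run-local L L′ ((β , _) ∷ w)      c c′ x agree =
  cong₂ applySwap (agree (shift w) (m≤n⇒m≤1+n (∣shift∣≤length w)))
                  (run-local L L′ w c c′ x (λ δ δ≤ → agree δ (m≤n⇒m≤1+n δ≤)))
run-local L L′ ((suc _ , _) ∷ w)  c c′ x agree =
  run-local L L′ w c c′ x (λ δ δ≤ → agree δ (m≤n⇒m≤1+n δ≤))

run-none : ∀ w c x → run (λ _ → none) w c x ≡ x
run-none []                c x = refl
run-none ((β , _) ∷ w)     c x = run-none w c x
run-none ((suc _ , _) ∷ w) c x = run-none w c x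

run-≥3 : ∀ L w c x → run L w c (3 + x) ≡ 3 + x
run-≥3 L []                c x = refl
run-≥3 L ((β , _) ∷ w)     c x rewrite run-≥3 L w c x = applySwap-≥3 (L (c ℤ.+ shift w)) x
run-≥3 L ((suc _ , _) ∷ w) c x = run-≥3 L w c x

Supported : ℕ → Labelling → Set
Supported M L = ∀ c → M < ∣ c ∣ → L c ≡ none

far-from-centre : ∀ M l c δ → M + l < ∣ c ∣ → ∣ δ ∣ ≤ l → M < ∣ c ℤ.+ δ ∣
far-from-centre M l c δ far δ≤l = +-cancelʳ-< l M ∣ c ℤ.+ δ ∣ (begin-strict
  M + l                   <⟨ far ⟩
  ∣ c ∣                   ≡⟨ cong ∣_∣ (c≡ c δ) ⟩
  ∣ c ℤ.+ δ ℤ.- δ ∣       ≤⟨ ℤₚ.∣i-j∣≤∣i∣+∣j∣ (c ℤ.+ δ) δ ⟩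
  ∣ c ℤ.+ δ ∣ + ∣ δ ∣     ≤⟨ +-monoʳ-≤ ∣ c ℤ.+ δ ∣ δ≤l ⟩
  ∣ c ℤ.+ δ ∣ + l         ∎)
  where
  open ≤-Reasoning
  c≡ : ∀ c δ → c ≡ c ℤ.+ δ ℤ.- δ
  c≡ = solve-∀

run-outside-support : ∀ M L w c x → Supported M L → M + length w < ∣ c ∣ → run L w c x ≡ x
run-outside-support M L w c x supported far =
  trans (run-local L (λ _ → none) w c c x
                   (λ δ δ≤ → supported (c ℤ.+ δ) (far-from-centre M (length w) c δ far δ≤)))
        (run-none w c x)

all-within? : ∀ {P : ℤ → Set} → (∀ c → Dec (P c)) → ∀ N → Dec (∀ c → ∣ c ∣ ≤ N → P c)
all-within? {P} P? zero    = map′ (λ p0 → λ { (+ zero) _ → p0 }) (λ all → all 0ℤ z≤n) (P? 0ℤ)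
all-within? {P} P? (suc N) =
  map′ (λ { (p₊ , p₋ , inner) c ∣c∣≤ → extend p₊ p₋ inner c ∣c∣≤ })
       (λ all → all (+ suc N) ≤-refl , all -[1+ N ] ≤-refl , λ c ∣c∣≤ → all c (m≤n⇒m≤1+n ∣c∣≤))
       (P? (+ suc N) ×-dec P? -[1+ N ] ×-dec all-within? P? N)
  where
  extend : P (+ suc N) → P -[1+ N ] → (∀ c → ∣ c ∣ ≤ N → P c) → ∀ c → ∣ c ∣ ≤ suc N → P c
  extend p₊ p₋ inner c ∣c∣≤ with m≤n⇒m<n∨m≡n ∣c∣≤
  ... | inj₁ ∣c∣<                    = inner c (s≤s⁻¹ ∣c∣<)
  extend p₊ p₋ inner (+ _)    _ | inj₂ refl = p₊
  extend p₊ p₋ inner -[1+ _ ] _ | inj₂ refl = p₋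

fixes? : ∀ M L → Supported M L → ∀ w → Dec (Fixes L w)
fixes? M L supported w =
  map′ (λ near c x → everywhere near c x) (λ fixes c _ → fixes c 0 , fixes c 1 , fixes c 2)
       (all-within? (λ c → (run L w c 0 ≟ 0) ×-dec (run L w c 1 ≟ 1) ×-dec (run L w c 2 ≟ 2)) (M + length w))
  where
  Near : ℤ → Set
  Near c = run L w c 0 ≡ 0 × run L w c 1 ≡ 1 × run L w c 2 ≡ 2
  everywhere : (∀ c → ∣ c ∣ ≤ M + length w → Near c) → Fixes L w
  everywhere near c x with ∣ c ∣ ≤? M + length w
  ... | no far    = run-outside-support M L w c x supported (≰⇒> far)
  ... | yes ∣c∣≤ = near-fixes (near c ∣c∣≤) x
    where
    near-fixes : Near c → ∀ x → run L w c x ≡ x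
    near-fixes (fix₀ , _ , _) 0 = fix₀
    near-fixes (_ , fix₁ , _) 1 = fix₁
    near-fixes (_ , _ , fix₂) 2 = fix₂
    near-fixes _ (suc (suc (suc x))) = run-≥3 L w c x

trivial? : ∀ M L → Supported M L → ∀ w → Dec (Trivial L w)
trivial? M L supported w = (shift w ℤ.≟ 0ℤ) ×-dec fixes? M L supported w

σ-power σ⁻-power : ℕ → Word → Word
σ-power  zero    w = w
σ-power  (suc j) w = (σ , true) ∷ σ-power j w
σ⁻-power zero    w = w
σ⁻-power (suc j) w = (σ , false) ∷ σ⁻-power j w

shift-σ-power : ∀ j w → shift (σ-power j w) ≡ shift w ℤ.+ + j
shift-σ-power zero    w = sym (ℤₚ.+-identityʳ (shift w))
shift-σ-power (suc j) w rewrite shift-σ-power j w =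
  trans (ℤₚ.+-assoc (shift w) (+ j) 1ℤ) (cong (λ i → shift w ℤ.+ + i) (+-comm j 1))

shift-σ⁻-power : ∀ j w → shift (σ⁻-power j w) ≡ shift w ℤ.- + j
shift-σ⁻-power zero    w = sym (ℤₚ.+-identityʳ (shift w))
shift-σ⁻-power (suc j) w rewrite shift-σ⁻-power j w =
  trans (ℤₚ.+-assoc (shift w) (ℤ.- + j) -1ℤ) (cong (λ i → shift w ℤ.+ i) (-j-1≡ j))
  where
  -j-1≡ : ∀ j → ℤ.- (+ j) ℤ.+ -1ℤ ≡ -[1+ j ]
  -j-1≡ zero    = refl
  -j-1≡ (suc j) = cong (λ i → -[1+ suc i ]) (+-identityʳ j)

run-σ-power : ∀ L j w c x → run L (σ-power j w) c x ≡ run L w c x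
run-σ-power L zero    w c x = refl
run-σ-power L (suc j) w c x = run-σ-power L j w c x

run-σ⁻-power : ∀ L j w c x → run L (σ⁻-power j w) c x ≡ run L w c x
run-σ⁻-power L zero    w c x = refl
run-σ⁻-power L (suc j) w c x = run-σ⁻-power L j w c x

βPair : ℕ → Word → Word
βPair j w = (β , true) ∷ σ-power j ((β , true) ∷ σ⁻-power j w)

shift-βPair : ∀ j w → shift (βPair j w) ≡ shift w
shift-βPair j w rewrite shift-σ-power j ((β , true) ∷ σ⁻-power j w) | shift-σ⁻-power j w = cancel (shift w) (+ j)
  where
  cancel : ∀ s i → s ℤ.- i ℤ.+ i ≡ s
  cancel = solve-∀

run-βPair : ∀ L j w c x → run L (βPair j w) c x ≡
            applySwap (L (c ℤ.+ shift w)) (applySwap (L (c ℤ.+ (shift w ℤ.- + j))) (run L w c x))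
run-βPair L j w c x
  rewrite run-σ-power L j ((β , true) ∷ σ⁻-power j w) c x | run-σ⁻-power L j w c x
        | shift-βPair j w | shift-σ⁻-power j w = refl

testWord : ℕ → Word
testWord n = βPair (suc n) (βPair (suc n) [])

shift-testWord : ∀ n → shift (testWord n) ≡ 0ℤ
shift-testWord n = trans (shift-βPair (suc n) _) (shift-βPair (suc n) [])

run-testWord : ∀ L n c x → run L (testWord n) c x ≡ square (L c) (L (c ℤ.- + suc n)) x
run-testWord L n c x =
  trans (run-βPair₀ (βPair (suc n) []) (shift-βPair (suc n) []))
        (cong (λ y → applySwap (L c) (applySwap (L (c ℤ.- + suc n)) y)) (run-βPair₀ [] refl))
  where
  run-βPair₀ : ∀ w → shift w ≡ 0ℤ →
               run L (βPair (suc n) w) c x ≡ applySwap (L c) (applySwap (L (c ℤ.- + suc n)) (run L w c x))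
  run-βPair₀ w shift≡0 rewrite run-βPair L (suc n) w c x | shift≡0 | ℤₚ.+-identityʳ c = refl

data Copy : Set where
  only₁₂ only₀₁ : Copy
  both          : ℕ → Copy

swap₁₂If : ∀ {A : Set} → Dec A → Swap
swap₁₂If (yes _) = swap₁₂
swap₁₂If (no _)  = none

label : Copy → Labelling
label _        -[1+ _ ]  = none
label only₁₂   (+ zero)  = swap₁₂
label only₀₁   (+ zero)  = swap₀₁
label (both n) (+ zero)  = swap₀₁
label only₁₂   (+ suc _) = none
label only₀₁   (+ suc _) = none
label (both n) (+ suc m) = swap₁₂If (m ≟ n)

radius : Copy → ℕ
radius (both n) = suc n
radius _        = 0

label-supported : ∀ C → Supported (radius C) (label C)
label-supported only₁₂   (+ suc _)  _ = refl
label-supported only₁₂   -[1+ _ ]   _ = refl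
label-supported only₀₁   (+ suc _)  _ = refl
label-supported only₀₁   -[1+ _ ]   _ = refl
label-supported (both n) (+ suc m)  n<m with m ≟ n
... | yes refl = contradiction n<m (n≮n _)
... | no _     = refl
label-supported (both n) -[1+ _ ]   _ = refl

label-swap₀₁ : ∀ C d → label C d ≡ swap₀₁ → d ≡ 0ℤ
label-swap₀₁ only₀₁   (+ zero)  _ = refl
label-swap₀₁ (both n) (+ zero)  _ = refl
label-swap₀₁ (both n) (+ suc m) eq with m ≟ n
label-swap₀₁ (both n) (+ suc m) () | yes _
label-swap₀₁ (both n) (+ suc m) () | no _

label-swap₁₂ : ∀ C m → label C (+ suc m) ≡ swap₁₂ → C ≡ both m
label-swap₁₂ (both n) m eq with m ≟ n
label-swap₁₂ (both n) m eq | yes refl = refl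
label-swap₁₂ (both n) m () | no _

testWord-trivial : ∀ n C → C ≢ both n → Trivial (label C) (testWord n)
testWord-trivial n C C≢both = shift-testWord n ,
  λ c x → trans (run-testWord (label C) n c x) (square-identity _ _ (noClash c) x)
  where
  noClash : ∀ c → ¬ Clash (label C c) (label C (c ℤ.- + suc n))
  noClash c (inj₁ (at-c , at-c-n-1)) with refl ← label-swap₀₁ C c at-c = contradiction at-c-n-1 λ ()
  noClash c (inj₂ (at-c , at-c-n-1)) with refl ← ℤₚ.i-j≡0⇒i≡j c (+ suc n) (label-swap₀₁ C _ at-c-n-1) =
    C≢both (label-swap₁₂ C n at-c)

testWord-nontrivial : ∀ n → ¬ Fixes (label (both n)) (testWord n)
testWord-nontrivial n fixes = squares-to-identity (trans (sym (run-testWord (label (both n)) n (+ suc n) 0)) (fixes _ 0))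
  where
  squares-to-identity : square (label (both n) (+ suc n)) (label (both n) (+ suc n ℤ.- + suc n)) 0 ≢ 0
  squares-to-identity rewrite ℤₚ.+-inverseʳ (+ suc n) | ≟-diag (refl {x = n}) = λ ()

label-both-near : ∀ n d → ∣ d ∣ ≤ n → label (both n) d ≡ label only₀₁ d
label-both-near n (+ zero)  _ = refl
label-both-near n (+ suc m) m<n with m ≟ n
... | yes refl = contradiction m<n (n≮n _)
... | no _     = refl
label-both-near n -[1+ _ ]  _ = refl

label-both-away : ∀ n d → 0 < ∣ d ∣ → label (both n) d ≡ label only₁₂ (d ℤ.- + suc n)
label-both-away n (+ suc m) _ with m ≟ n
... | yes refl rewrite ℤₚ.+-inverseʳ (+ suc m) = refl
... | no m≢n   = sym (elsewhere (λ eq → m≢n (suc-injective (ℤₚ.+-injective (ℤₚ.i-j≡0⇒i≡j _ _ eq)))))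
  where
  elsewhere : ∀ {d} → d ≢ 0ℤ → label only₁₂ d ≡ none
  elsewhere {+ zero}   d≢0 = contradiction refl d≢0
  elsewhere {+ suc _}  _   = refl
  elsewhere { -[1+ _ ]} _   = refl
label-both-away n -[1+ m ]  _ = refl

both-trivial : ∀ n w → length w + length w ≤ n →
               Trivial (label only₀₁) w → Fixes (label only₁₂) w → Trivial (label (both n)) w
both-trivial n w 2l≤n (shift≡0 , fixes₀₁) fixes₁₂ = shift≡0 , fixes
  where
  l = length w
  fixes : Fixes (label (both n)) w
  fixes c x with ∣ c ∣ ≤? l
  ... | yes ∣c∣≤l = trans (run-local _ _ w c c x near) (fixes₀₁ c x)
    where
    near : ∀ δ → ∣ δ ∣ ≤ l → label (both n) (c ℤ.+ δ) ≡ label only₀₁ (c ℤ.+ δ)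
    near δ δ≤l = label-both-near n (c ℤ.+ δ)
      (≤-trans (ℤₚ.∣i+j∣≤∣i∣+∣j∣ c δ) (≤-trans (+-mono-≤ ∣c∣≤l δ≤l) 2l≤n))
  ... | no ∣c∣≰l = trans (run-local _ _ w c (c ℤ.- + suc n) x away) (fixes₁₂ _ x)
    where
    away : ∀ δ → ∣ δ ∣ ≤ l → label (both n) (c ℤ.+ δ) ≡ label only₁₂ (c ℤ.- + suc n ℤ.+ δ)
    away δ δ≤l = trans (label-both-away n (c ℤ.+ δ) (far-from-centre 0 l c δ (≰⇒> ∣c∣≰l) δ≤l))
                       (cong (label only₁₂) (reassociate c δ (+ suc n)))
      where
      reassociate : ∀ c δ j → c ℤ.+ δ ℤ.- j ≡ c ℤ.- j ℤ.+ δ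
      reassociate = solve-∀

-- absent i records that copy both (toℕ i) does not occur; copies both n with n ≥ 2 ∣w∣
-- need no query, by both-trivial.
TrivialGiven : (w : Word) → (Fin (length w + length w) → Set) → Set
TrivialGiven w absent =
  Trivial (label only₀₁) w × Trivial (label only₁₂) w × (∀ i → absent i ⊎ Trivial (label (both (toℕ i))) w)

copyTrivial? : ∀ C w → Dec (Trivial (label C) w)
copyTrivial? C = trivial? (radius C) (label C) (label-supported C)

trivialGiven? : ∀ w {absent} → (∀ i → Dec (absent i)) → Dec (TrivialGiven w absent)
trivialGiven? w absent? =
  copyTrivial? only₀₁ w ×-dec copyTrivial? only₁₂ w ×-dec
  all? (λ i → absent? i ⊎-dec copyTrivial? (both (toℕ i)) w)

TrivialGiven-cong : ∀ w {absent absent′} → (∀ i → absent i ⇔ absent′ i) →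
                    TrivialGiven w absent ⇔ TrivialGiven w absent′
TrivialGiven-cong w same = mk⇔
  (λ (t₀₁ , t₁₂ , given) → t₀₁ , t₁₂ , λ i → Sum.map₁ (Equivalence.to (same i)) (given i))
  (λ (t₀₁ , t₁₂ , given) → t₀₁ , t₁₂ , λ i → Sum.map₁ (Equivalence.from (same i)) (given i))

≤tt-from-⇔ : ∀ {X Y : Set} {A : X → Set} {B : Y → Set} (f : X → Y) → (∀ x → A x ⇔ B (f x)) → A ≤tt B
≤tt-from-⇔ f A⇔B = (λ x → 1 , f x ∷ [] , λ bs → lookup bs zero) ,
                   λ x bs answer → ⇔-sym (answer zero) ⇔-∘ A⇔B x

does⇔ : ∀ {P : Set} (P? : Dec P) → (does P? ≡ true) ⇔ P
does⇔ (yes p) = mk⇔ (λ _ → p) (λ _ → refl)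
does⇔ (no ¬p) = mk⇔ (λ ()) (λ p → contradiction p ¬p)

module Construction (p : PR 2) where

  -- stageSum n s ≠ 0 iff some t < s witnesses n ∉ PiSet p.
  stageSum : ℕ → ℕ → ℕ
  stageSum n zero    = 0
  stageSum n (suc s) = stageSum n s + evalPR p (n ∷ s ∷ [])

  copyOf : ℕ → ℕ → Copy
  copyOf zero    s = only₁₂
  copyOf (suc n) s with stageSum n s
  ... | zero  = only₀₁
  ... | suc _ = both n

  stageSum-PiSet : ∀ {n} → PiSet p n → ∀ s → stageSum n s ≡ 0
  stageSum-PiSet n∈S zero    = refl
  stageSum-PiSet n∈S (suc s) rewrite stageSum-PiSet n∈S s = n∈S s

  copyOf-both : ∀ k s {n} → copyOf k s ≡ both n → ¬ PiSet p n
  copyOf-both (suc k) s eq n∈S with stageSum k s in sum≡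
  copyOf-both (suc k) s refl n∈S | suc _ = contradiction (trans (sym sum≡) (stageSum-PiSet n∈S s)) λ ()

  copyOf-refuted : ∀ {n t m} → evalPR p (n ∷ t ∷ []) ≡ suc m → copyOf (suc n) (suc t) ≡ both n
  copyOf-refuted {n} {t} {m} eq with stageSum n (suc t) in sum≡
  ... | suc _ = refl
  ... | zero  = contradiction (trans (sym sum≡) (trans (cong (λ e → stageSum n t + e) eq) (+-suc (stageSum n t) m))) λ ()

  PiSet-if-absent : ∀ {n} (Q : Copy → Set) → (∀ k s → Q (copyOf k s)) → ¬ Q (both n) → PiSet p n
  PiSet-if-absent {n} Q everywhere ¬Q t with evalPR p (n ∷ t ∷ []) in eq
  ... | zero  = refl
  ... | suc _ = contradiction (subst Q (copyOf-refuted eq) (everywhere (suc n) (suc t))) ¬Q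

  -- β on the fibre point x over the position with zigzag code m in copy (k , s);
  -- ∣ m - k + k ∣ ≡ 0 tests m ≡ encodeℤ (+ k).
  βstep : ℕ → ℕ → ℕ → ℕ → ℕ
  βstep m k s x =
    ifz k (ifz m (applySwap swap₁₂ x) x)
          (ifz m (applySwap swap₀₁ x) (ifz ∣ m - k + k ∣ (ifz (stageSum (pred k) s) x (applySwap swap₁₂ x)) x))

  βstep-correct : ∀ c k s x → βstep (encodeℤ c) k s x ≡ applySwap (label (copyOf k s) c) x
  βstep-correct (+ zero)  zero    s x = refl
  βstep-correct (+ suc _) zero    s x = refl
  βstep-correct -[1+ _ ]  zero    s x = refl
  βstep-correct (+ zero)  (suc n) s x with stageSum n s
  ... | zero  = refl
  ... | suc _ = refl
  βstep-correct (+ suc m) (suc n) s x with stageSum n s | m ≟ n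
  ... | zero  | yes refl rewrite ∣n-n∣≡0 (encodeℤ (+ suc m)) = refl
  ... | suc _ | yes refl rewrite ∣n-n∣≡0 (encodeℤ (+ suc m)) | ≟-diag (refl {x = m}) = refl
  ... | e     | no m≢n
    rewrite ifz-∣-∣ {a = ifz e x (applySwap swap₁₂ x)} {b = x}
                    (λ eq → m≢n (suc-injective (ℤₚ.+-injective (encodeℤ-injective eq))))
    with e
  ...   | zero  = refl
  ...   | suc _ rewrite dec-no (m ≟ n) m≢n = refl
  βstep-correct -[1+ m ]  (suc n) s x
    rewrite ifz-∣-∣ {a = ifz (stageSum n s) x (applySwap swap₁₂ x)} {b = x}
                    (λ eq → contradiction (encodeℤ-injective { -[1+ m ]} {+ suc n} eq) λ ())
    = refl

  stageSumᴾ : PRFun 2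
  stageSumᴾ = recursion zeroᴾ (addᴾ ⟨ x₀ , prFun p (evalPR p) (λ _ → refl) ⟨ x₂ , x₁ ⟩₂ ⟩₂)
                        (λ { (s ∷ n ∷ []) → stageSum n s }) (λ { (n ∷ []) → refl }) (λ { s (n ∷ []) → refl })

  βstepᴾ : PRFun 4
  βstepᴾ = ifzᴾ ⟨ x₁ , ifzᴾ ⟨ x₀ , swapᴾ swap₁₂ ⟨ x₃ ⟩₁ , x₃ ⟩₃ ,
                ifzᴾ ⟨ x₀ , swapᴾ swap₀₁ ⟨ x₃ ⟩₁ ,
                       ifzᴾ ⟨ distanceᴾ ⟨ x₀ , addᴾ ⟨ x₁ , x₁ ⟩₂ ⟩₂ ,
                              ifzᴾ ⟨ stageSumᴾ ⟨ x₂ , predᴾ ⟨ x₁ ⟩₁ ⟩₂ , x₃ , swapᴾ swap₁₂ ⟨ x₃ ⟩₁ ⟩₃ ,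
                              x₃ ⟩₃ ⟩₃ ⟩₃

  βᴾ : PRFun 1
  βᴾ = pairᴾ ⟨ unpair₁ᴾ , pairᴾ ⟨ k , pairᴾ ⟨ s , compose βstepᴾ (unpair₁ᴾ ∷ k ∷ s ∷ x ∷ []) ⟩₂ ⟩₂ ⟩₂
    where
    k s x : PRFun 1
    k = unpair₁ᴾ ⟨ unpair₂ᴾ ⟩₁
    s = unpair₁ᴾ ⟨ unpair₂ᴾ ⟨ unpair₂ᴾ ⟩₁ ⟩₁
    x = unpair₂ᴾ ⟨ unpair₂ᴾ ⟨ unpair₂ᴾ ⟩₁ ⟩₁

  β-encodePoint : ∀ c k s x →
    ⟦ code βᴾ ⟧₁ (encodePoint c k s x) ≡ encodePoint c k s (applySwap (label (copyOf k s) c) x)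
  β-encodePoint c k s x = trans (code-correct βᴾ (encodePoint c k s x ∷ [])) unfolded
    where
    unfolded : fun βᴾ (encodePoint c k s x ∷ []) ≡ encodePoint c k s (applySwap (label (copyOf k s) c) x)
    unfolded rewrite unpair₁-pair (encodeℤ c) (pair k (pair s x)) | unpair₂-pair (encodeℤ c) (pair k (pair s x))
                   | unpair₁-pair k (pair s x) | unpair₂-pair k (pair s x) | unpair₁-pair s x | unpair₂-pair s x
                   = cong (encodePoint c k s) (βstep-correct c k s x)

  generators : Fin 3 → PR 1 × PR 1
  generators β = code βᴾ , code βᴾ
  generators σ = code σᴾ , code σ⁻ᴾ
  generators τ = code x₀ , code x₀

  evalWord-encodePoint : ∀ w c k s x →
    evalWord (gensOf generators) w (encodePoint c k s x) ≡ encodePoint (c ℤ.+ shift w) k s (run (label (copyOf k s)) w c x)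
  evalWord-encodePoint []              c k s x = cong (λ d → encodePoint d k s x) (sym (ℤₚ.+-identityʳ c))
  evalWord-encodePoint ((β , true) ∷ w)  c k s x =
    trans (cong ⟦ code βᴾ ⟧₁ (evalWord-encodePoint w c k s x))
          (β-encodePoint (c ℤ.+ shift w) k s (run (label (copyOf k s)) w c x))
  evalWord-encodePoint ((β , false) ∷ w) c k s x =
    trans (cong ⟦ code βᴾ ⟧₁ (evalWord-encodePoint w c k s x))
          (β-encodePoint (c ℤ.+ shift w) k s (run (label (copyOf k s)) w c x))
  evalWord-encodePoint ((σ , true) ∷ w)  c k s x =
    trans (cong ⟦ code σᴾ ⟧₁ (evalWord-encodePoint w c k s x))
          (trans (σ-encodePoint (c ℤ.+ shift w) k s x′)
                 (cong (λ d → encodePoint d k s x′) (ℤₚ.+-assoc c (shift w) 1ℤ)))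
    where x′ = run (label (copyOf k s)) w c x
  evalWord-encodePoint ((σ , false) ∷ w) c k s x =
    trans (cong ⟦ code σ⁻ᴾ ⟧₁ (evalWord-encodePoint w c k s x))
          (trans (σ⁻-encodePoint (c ℤ.+ shift w) k s x′)
                 (cong (λ d → encodePoint d k s x′) (ℤₚ.+-assoc c (shift w) -1ℤ)))
    where x′ = run (label (copyOf k s)) w c x
  evalWord-encodePoint ((τ , true) ∷ w)  c k s x = evalWord-encodePoint w c k s x
  evalWord-encodePoint ((τ , false) ∷ w) c k s x = evalWord-encodePoint w c k s x

  generators-FPRPerm : ∀ i → FPRPerm (proj₁ (generators i)) (proj₂ (generators i))
  generators-FPRPerm β = β-involutive , β-involutive
    where
    β-involutive : ∀ z → ⟦ code βᴾ ⟧₁ (⟦ code βᴾ ⟧₁ z) ≡ z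
    β-involutive = point-induction (λ z → ⟦ code βᴾ ⟧₁ (⟦ code βᴾ ⟧₁ z) ≡ z) λ c k s x →
      trans (cong ⟦ code βᴾ ⟧₁ (β-encodePoint c k s x))
            (trans (β-encodePoint c k s (applySwap (label (copyOf k s) c) x))
                   (cong (encodePoint c k s) (applySwap-involutive (label (copyOf k s) c) x)))
  generators-FPRPerm σ = σ-after-σ⁻ , σ⁻-after-σ
    where
    σ-after-σ⁻ : ∀ z → ⟦ code σᴾ ⟧₁ (⟦ code σ⁻ᴾ ⟧₁ z) ≡ z
    σ-after-σ⁻ = point-induction (λ z → ⟦ code σᴾ ⟧₁ (⟦ code σ⁻ᴾ ⟧₁ z) ≡ z) λ c k s x →
      trans (cong ⟦ code σᴾ ⟧₁ (σ⁻-encodePoint c k s x))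
            (trans (σ-encodePoint (c ℤ.+ -1ℤ) k s x) (cong (λ d → encodePoint d k s x) (cancel c)))
      where
      cancel : ∀ c → c ℤ.+ -1ℤ ℤ.+ 1ℤ ≡ c
      cancel = solve-∀
    σ⁻-after-σ : ∀ z → ⟦ code σ⁻ᴾ ⟧₁ (⟦ code σᴾ ⟧₁ z) ≡ z
    σ⁻-after-σ = point-induction (λ z → ⟦ code σ⁻ᴾ ⟧₁ (⟦ code σᴾ ⟧₁ z) ≡ z) λ c k s x →
      trans (cong ⟦ code σ⁻ᴾ ⟧₁ (σ-encodePoint c k s x))
            (trans (σ⁻-encodePoint (c ℤ.+ 1ℤ) k s x) (cong (λ d → encodePoint d k s x) (cancel c)))
      where
      cancel : ∀ c → c ℤ.+ 1ℤ ℤ.+ -1ℤ ≡ c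
      cancel = solve-∀
  generators-FPRPerm τ = (λ _ → refl) , (λ _ → refl)

  wordProblem⇔copiesTrivial : ∀ w → WordProblem generators w ⇔ (∀ k s → Trivial (label (copyOf k s)) w)
  wordProblem⇔copiesTrivial w = mk⇔ trivial-in-copies identity
    where
    trivial-in-copies : WordProblem generators w → ∀ k s → Trivial (label (copyOf k s)) w
    trivial-in-copies wp k s = trans (sym (ℤₚ.+-identityˡ (shift w))) (cong proj₁ (decoded 0ℤ 0)) ,
                               λ c x → cong (λ p → proj₂ (proj₂ (proj₂ p))) (decoded c x)
      where
      decoded : ∀ c x → (c ℤ.+ shift w , k , s , run (label (copyOf k s)) w c x) ≡ (c , k , s , x)
      decoded c x = begin
        (c ℤ.+ shift w , k , s , x′)                        ≡⟨ decodePoint-encodePoint (c ℤ.+ shift w) k s x′ ⟨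
        decodePoint (encodePoint (c ℤ.+ shift w) k s x′)    ≡⟨ cong decodePoint (evalWord-encodePoint w c k s x) ⟨
        decodePoint (evalWord (gensOf generators) w point)  ≡⟨ cong decodePoint (wp point) ⟩
        decodePoint point                                   ≡⟨ decodePoint-encodePoint c k s x ⟩
        (c , k , s , x)                                     ∎
        where
        open ≡-Reasoning
        point = encodePoint c k s x
        x′    = run (label (copyOf k s)) w c x
    identity : (∀ k s → Trivial (label (copyOf k s)) w) → WordProblem generators w
    identity trivial = point-induction (λ z → evalWord (gensOf generators) w z ≡ z) λ c k s x →
      trans (evalWord-encodePoint w c k s x)
            (cong₂ (λ d y → encodePoint d k s y)
                   (trans (cong (λ i → c ℤ.+ i) (proj₁ (trivial k s))) (ℤₚ.+-identityʳ c))
                   (proj₂ (trivial k s) c x))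

  piSet⇔testWord : ∀ n → PiSet p n ⇔ WordProblem generators (testWord n)
  piSet⇔testWord n = mk⇔
    (λ n∈S → Equivalence.from (wordProblem⇔copiesTrivial (testWord n))
               λ k s → testWord-trivial n (copyOf k s) (λ eq → copyOf-both k s eq n∈S))
    (λ wp → PiSet-if-absent (λ C → Fixes (label C) (testWord n))
              (λ k s → proj₂ (Equivalence.to (wordProblem⇔copiesTrivial (testWord n)) wp k s))
              (testWord-nontrivial n))

  copiesTrivial⇔trivialGiven : ∀ w → (∀ k s → Trivial (label (copyOf k s)) w) ⇔ TrivialGiven w (PiSet p ∘ toℕ)
  copiesTrivial⇔trivialGiven w = mk⇔ given everywhere
    where
    l = length w
    given : (∀ k s → Trivial (label (copyOf k s)) w) → TrivialGiven w (PiSet p ∘ toℕ)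
    given trivial = trivial 1 0 , trivial 0 0 , λ i → absent-or-trivial (toℕ i)
      where
      absent-or-trivial : ∀ n → PiSet p n ⊎ Trivial (label (both n)) w
      absent-or-trivial n with copyTrivial? (both n) w
      ... | yes t = inj₂ t
      ... | no ¬t = inj₁ (PiSet-if-absent (λ C → Trivial (label C) w) trivial ¬t)
    everywhere : TrivialGiven w (PiSet p ∘ toℕ) → ∀ k s → Trivial (label (copyOf k s)) w
    everywhere (t₀₁ , t₁₂ , given) k s with copyOf k s in eq
    ... | only₁₂ = t₁₂
    ... | only₀₁ = t₀₁
    ... | both n with n <? l + l
    ...   | no n≮2l = both-trivial n w (≮⇒≥ n≮2l) t₀₁ (proj₂ t₁₂)
    ...   | yes n<2l with given (fromℕ< n<2l)
    ...     | inj₁ n∈S = contradiction (subst (PiSet p) (toℕ-fromℕ< n<2l) n∈S) (copyOf-both k s eq)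
    ...     | inj₂ t   = subst (λ m → Trivial (label (both m)) w) (toℕ-fromℕ< n<2l) t

  piSet≤ttWordProblem : PiSet p ≤tt WordProblem generators
  piSet≤ttWordProblem = ≤tt-from-⇔ {B = WordProblem generators} testWord piSet⇔testWord

  wordProblem≤ttPiSet : WordProblem generators ≤tt PiSet p
  wordProblem≤ttPiSet = (λ w → length w + length w , tabulate toℕ , table w) , correct
    where
    decide : ∀ w (bs : Vec Bool (length w + length w)) → Dec (TrivialGiven w (λ i → lookup bs i ≡ true))
    decide w bs = trivialGiven? w (λ i → lookup bs i Bool.≟ true)
    table : ∀ w → Vec Bool (length w + length w) → Bool
    table w bs = does (decide w bs)
    correct : ∀ w bs → (∀ i → (lookup bs i ≡ true) ⇔ PiSet p (lookup (tabulate toℕ) i)) →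
              WordProblem generators w ⇔ (table w bs ≡ true)
    correct w bs answers =
      ⇔-sym (does⇔ (decide w bs)) ⇔-∘
      (TrivialGiven-cong w answered ⇔-∘ (copiesTrivial⇔trivialGiven w ⇔-∘ wordProblem⇔copiesTrivial w))
      where
      answered : ∀ i → PiSet p (toℕ i) ⇔ (lookup bs i ≡ true)
      answered i = ⇔-sym (subst (λ n → (lookup bs i ≡ true) ⇔ PiSet p n) (lookup∘tabulate toℕ i) (answers i))

theorem5p2 : Σ (PR 2 → Fin 3 → PR 1 × PR 1) λ Φ →
    ∀ (p : PR 2) →
      (∀ (i : Fin 3) → FPRPerm (proj₁ (Φ p i)) (proj₂ (Φ p i)))
      × (WordProblem (Φ p) ≡tt PiSet p)
theorem5p2 = Construction.generators , λ p →
  let open Construction p in generators-FPRPerm , wordProblem≤ttPiSet , piSet≤ttWordProblem
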